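{- Let $m,n \geq 4$ be integers and let $G=G_{n,m}$ be the $n \times m$ grid graph. For every connected dominating set $S$ of $G$, \[ |S| \geq \left\lceil \frac{mn+2\left\lceil \frac{\min \{m,n\}}{3}\right\rceil}{3} \right\rceil . \] Equivalently, the connected domination number satisfies $\gamma_c(G_{n,m}) \geq \left\lceil \frac{mn+2\lceil \min\{m,n\}/3\rceil}{3}\right\rceil$.
   Context: The grid graph $G_{n,m}$ has vertex set $\{1,\dots,n\}\times\{1,\dots,m\}$, with $(i_1,j_1)$ and $(i_2,j_2)$ adjacent iff $|i_1-i_2|+|j_1-j_2|=1$. A connected dominating set of a graph $G=(V,E)$ is a set $S \subseteq V$ such that the induced subgraph $G[S]$ is connected and every vertex of $V$ is in $S$ or adjacent to a vertex of $S$. $\gamma_c(G)$ is the minimum size of a connected dominating set. -}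

module Defs where

open import Data.Nat using (ℕ; zero; suc; _+_; _*_; _∸_; _/_; _⊓_)
open import Data.Fin using (Fin; toℕ)
open import Data.Product using (_×_; _,_; ∃-syntax)
open import Data.Sum using (_⊎_)
open import Data.List using (List; length)
open import Data.List.Membership.Propositional using (_∈_)
open import Relation.Binary.PropositionalEquality using (_≡_)

dist : ℕ → ℕ → ℕ
dist a b = (a ∸ b) + (b ∸ a)

Vertex : ℕ → ℕ → Set
Vertex n m = Fin n × Fin m

Adj : ∀ {n m} → Vertex n m → Vertex n m → Set
Adj (i₁ , j₁) (i₂ , j₂) = dist (toℕ i₁) (toℕ i₂) + dist (toℕ j₁) (toℕ j₂) ≡ 1

data Reach {n m : ℕ} (S : List (Vertex n m)) : Vertex n m → Vertex n m → Set where
  here  : ∀ {u} → u ∈ S → Reach S u u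
  step  : ∀ {u v w} → u ∈ S → Adj u v → Reach S v w → Reach S u w

InducedConnected : ∀ {n m} → List (Vertex n m) → Set
InducedConnected S = ∀ {u v} → u ∈ S → v ∈ S → Reach S u v

Dominating : ∀ {n m} → List (Vertex n m) → Set
Dominating {n} {m} S = ∀ (v : Vertex n m) → v ∈ S ⊎ ∃[ u ] (u ∈ S × Adj u v)

IsConnectedDominatingSet : ∀ {n m} → List (Vertex n m) → Set
IsConnectedDominatingSet S = InducedConnected S × Dominating S

⌈_/3⌉ : ℕ → ℕ
⌈ a /3⌉ = (a + 2) / 3

{-# OPTIONS --safe #-}
module Submission where

-- View the grid inside ℤ² and grow a spanning tree of S leaf by leaf.  The root dominates 5 points
-- and each leaf at most 3 new ones, fewer by the number of corners (pairs of perpendicular tree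
-- edges with a common end) that it creates; so 3|S| + 2 bounds the number of corners plus the number
-- of dominated points, which include the mn vertices and one point off the grid near each of its
-- four corners.  If the tree has h maximal segments in one direction, it has at least 2(h − 1)
-- corners.  Finally, the horizontal segments meet the closed neighbourhood of every row or the
-- vertical ones that of every column, so min(m,n) ≤ 3h for one of the directions.

open import Defs
open import Data.Bool using (Bool; true; false; if_then_else_)
open import Data.Fin using (Fin; toℕ; fromℕ; zero; combine; remQuot)
import Data.Fin.Properties as Fin
open import Data.Integer using (ℤ)
import Data.Integer as ℤ
import Data.Integer.Properties as ℤ
open import Data.List using (List; []; _∷_; [_]; _++_; length; map; concatMap; tabulate)
open import Data.Nat.ListAction using (sum)
import Data.List.Properties as List
open import Data.List.Membership.Propositional using (_∈_; _∉_; _∷=_)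
open import Data.List.Membership.Propositional.Properties
  using (∈-∃++; ∈-++⁺ˡ; ∈-++⁺ʳ; ∈-++⁻; ∈-map⁺; ∈-map⁻; ∈-concatMap⁺; ∈-tabulate⁻)
import Data.List.Membership.DecPropositional as DecMembership
open import Data.List.Relation.Binary.Subset.Propositional using (_⊆_)
open import Data.List.Relation.Unary.All as All using (All; []; _∷_)
open import Data.List.Relation.Unary.All.Properties using (¬Any⇒All¬)
open import Data.List.Relation.Unary.AllPairs using ([]; _∷_)
open import Data.List.Relation.Unary.Any as Any using (here; there)
open import Data.List.Relation.Unary.Unique.Propositional using (Unique)
import Data.List.Relation.Unary.Unique.Propositional.Properties as Unique
open import Data.Nat using (ℕ; zero; suc; _+_; _*_; _∸_; _≤_; _<_; _⊓_; z≤n; s≤s; _≤?_)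
open import Data.Nat.DivMod using (m<n*o⇒m/o<n)
open import Data.Nat.Properties
open import Data.Nat.Tactic.RingSolver using (solve-∀)
open import Data.Product using (_×_; _,_; proj₁; proj₂; ∃-syntax; uncurry)
open import Data.Product.Properties using (≡-dec)
open import Data.Sum using (_⊎_; inj₁; inj₂)
open import Function using (_∘_; id)
open import Relation.Binary.PropositionalEquality hiding ([_])
open import Relation.Nullary using (¬_; yes; no; contradiction)

private variable
  X : Set
  n m : ℕ

-- Lists: comparing lengths and replacing one entry.

Unique∧⊆⇒length≤ : {xs ys : List X} → Unique xs → xs ⊆ ys → length xs ≤ length ys
Unique∧⊆⇒length≤ [] _ = z≤n
Unique∧⊆⇒length≤ {xs = x ∷ xs} (x∉ ∷ uxs) sub with ∈-∃++ (sub (here refl))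
... | as , bs , refl = begin
  suc (length xs)          ≤⟨ s≤s (Unique∧⊆⇒length≤ uxs sub′) ⟩
  suc (length (as ++ bs))  ≡⟨ sym (List.length-++-sucʳ as x bs) ⟩
  length (as ++ x ∷ bs)    ∎
  where
  open ≤-Reasoning
  sub′ : xs ⊆ as ++ bs
  sub′ y∈ with ∈-++⁻ as (sub (there y∈))
  ... | inj₁ y∈as         = ∈-++⁺ˡ y∈as
  ... | inj₂ (here refl)  = contradiction refl (All.lookup x∉ y∈)
  ... | inj₂ (there y∈bs) = ∈-++⁺ʳ as y∈bs

∈-∷=⁻ : {xs : List X} {x y z : X} (i : x ∈ xs) → z ∈ (i ∷= y) → z ≡ y ⊎ z ∈ xs
∈-∷=⁻ (here _)  (here z≡)  = inj₁ z≡
∈-∷=⁻ (here _)  (there z∈) = inj₂ (there z∈)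
∈-∷=⁻ (there i) (here z≡)  = inj₂ (here z≡)
∈-∷=⁻ (there i) (there z∈) with ∈-∷=⁻ i z∈
... | inj₁ z≡ = inj₁ z≡
... | inj₂ z∈′ = inj₂ (there z∈′)

length-∷= : {xs : List X} {x y : X} (i : x ∈ xs) → length (i ∷= y) ≡ length xs
length-∷= (here _)  = refl
length-∷= (there i) = cong suc (length-∷= i)

-- Two offsets, since the weight of the updated entry may go up or down.
sum-∷= : (w : X → ℕ) {xs : List X} {x y : X} (i : x ∈ xs) → ∀ {j k} →
  w y + j ≡ w x + k → sum (map w (i ∷= y)) + j ≡ sum (map w xs) + k
sum-∷= w {x = x} {y} (here {xs = xs} refl) {j} {k} eq = begin
  w y + S + j    ≡⟨ swap (w y) S j ⟩
  w y + j + S    ≡⟨ cong (_+ S) eq ⟩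
  w x + k + S    ≡⟨ sym (swap (w x) S k) ⟩
  w x + S + k    ∎
  where
  open ≡-Reasoning
  S = sum (map w xs)
  swap : ∀ a b c → a + b + c ≡ a + c + b
  swap = solve-∀
sum-∷= w (there {x = z} i) {j} {k} eq =
  trans (+-assoc (w z) _ j) (trans (cong (w z +_) (sum-∷= w i eq)) (sym (+-assoc (w z) _ k)))

-- Directions and unit steps in ℤ².

data Axis : Set where
  hor ver : Axis

other : Axis → Axis
other hor = ver
other ver = hor

data Way : Set where
  fwd bwd : Way

opp : Way → Way
opp fwd = bwd
opp bwd = fwd

-- Splitting relative to a given axis treats the neighbours of a new leaf without fixing the
-- direction of its edge.
axis-cases : ∀ A {P : Axis → Set} → P A → P (other A) → ∀ B → P B
axis-cases hor p q hor = p
axis-cases hor p q ver = q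
axis-cases ver p q hor = q
axis-cases ver p q ver = p

way-cases : ∀ s {P : Way → Set} → P s → P (opp s) → ∀ t → P t
way-cases fwd p q fwd = p
way-cases fwd p q bwd = q
way-cases bwd p q fwd = q
way-cases bwd p q bwd = p

Point : Set
Point = ℤ × ℤ

shift : Way → ℤ → ℤ
shift fwd = ℤ.suc
shift bwd = ℤ.pred

shift-opp : ∀ s z → shift (opp s) (shift s z) ≡ z
shift-opp fwd = ℤ.pred-suc
shift-opp bwd = ℤ.suc-pred

move : Axis → Way → Point → Point
move hor s (i , j) = i , shift s j
move ver s (i , j) = shift s i , j

move-opp : ∀ A s x → move A (opp s) (move A s x) ≡ x
move-opp hor s (i , j) = cong (i ,_) (shift-opp s j)
move-opp ver s (i , j) = cong (_, j) (shift-opp s i)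

-- Closes a unit square: the point beside a new leaf, next to a perpendicular edge at its stem, is
-- also a neighbour of the far end of that edge.
move-comm : ∀ A s t x → move (other A) t (move A s x) ≡ move A s (move (other A) t x)
move-comm hor s t x = refl
move-comm ver s t x = refl

-- The coordinate that is constant along lines in direction A.
level : Axis → Point → ℤ
level hor = proj₁
level ver = proj₂

level-along : ∀ A s x → level A (move A s x) ≡ level A x
level-along hor s x = refl
level-along ver s x = refl

-- Trees grown leaf by leaf.

-- The directions of the tree edges at a vertex.
Flags : Set
Flags = Axis → Way → Bool

none : Flags
none _ _ = false

raise : Way → (Way → Bool) → (Way → Bool)
raise fwd g fwd = true
raise fwd g bwd = g bwd
raise bwd g fwd = g fwd
raise bwd g bwd = true

set : Axis → Way → Flags → Flags
set hor s f hor = raise s (f hor)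
set hor s f ver = f ver
set ver s f hor = f hor
set ver s f ver = raise s (f ver)

bit : Bool → ℕ
bit true  = 1
bit false = 0

deg : Axis → Flags → ℕ
deg A f = bit (f A fwd) + bit (f A bwd)

set⁻ : ∀ A s f B t → set A s f B t ≡ true → (B ≡ A × t ≡ s) ⊎ f B t ≡ true
set⁻ hor fwd f hor fwd _ = inj₁ (refl , refl)
set⁻ hor fwd f hor bwd e = inj₂ e
set⁻ hor bwd f hor fwd e = inj₂ e
set⁻ hor bwd f hor bwd _ = inj₁ (refl , refl)
set⁻ hor s   f ver t   e = inj₂ e
set⁻ ver s   f hor t   e = inj₂ e
set⁻ ver fwd f ver fwd _ = inj₁ (refl , refl)
set⁻ ver fwd f ver bwd e = inj₂ e
set⁻ ver bwd f ver fwd e = inj₂ e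
set⁻ ver bwd f ver bwd _ = inj₁ (refl , refl)

raise-bits : ∀ s g → g s ≡ false →
  bit (raise s g fwd) + bit (raise s g bwd) ≡ suc (bit (g fwd) + bit (g bwd))
raise-bits fwd g e rewrite e = refl
raise-bits bwd g e rewrite e = +-suc (bit (g fwd)) 0

deg-set-same : ∀ A s f → f A s ≡ false → deg A (set A s f) ≡ suc (deg A f)
deg-set-same hor s f = raise-bits s (f hor)
deg-set-same ver s f = raise-bits s (f ver)

deg-set-other : ∀ A s f → deg (other A) (set A s f) ≡ deg (other A) f
deg-set-other hor s f = refl
deg-set-other ver s f = refl

Node : Set
Node = Point × Flags

points : List Node → List Point
points = map proj₁

leaf : Axis → Way → Point → Node
leaf A s p = move A s p , set A (opp s) none

-- Every tree edge is flagged at both ends; adjacent points that no `grow` step joined stay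
-- unflagged.
data Grown : List Node → Set where
  root : ∀ x → Grown [ x , none ]
  grow : ∀ {L p f} → Grown L → (i : (p , f) ∈ L) → ∀ A s → move A s p ∉ points L →
         Grown (leaf A s p ∷ (i ∷= (p , set A s f)))

points-∷= : ∀ {L p f g} (i : (p , f) ∈ L) → points (i ∷= (p , g)) ≡ points L
points-∷= (here refl) = refl
points-∷= (there i)   = cong (_ ∷_) (points-∷= i)

grown-unique : ∀ {L} → Grown L → Unique (points L)
grown-unique (root x) = [] ∷ []
grown-unique (grow {L} G i A s v∉) = subst (λ ps → Unique (_ ∷ ps)) (sym (points-∷= i))
  (¬Any⇒All¬ _ v∉ ∷ grown-unique G)

edge-end : ∀ {L p f} → Grown L → (p , f) ∈ L → ∀ A s → f A s ≡ true → move A s p ∈ points L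
edge-end (root x) (here refl) A s ()
edge-end (grow {p = p} {f} G i A s v∉) (here refl) B t e with set⁻ A (opp s) none B t e
... | inj₁ (refl , refl) = there (subst₂ _∈_ (sym (move-opp A s p)) (sym (points-∷= i)) (∈-map⁺ proj₁ i))
... | inj₂ ()
edge-end (grow {p = p} {f} G i A s v∉) (there z∈) B t e with ∈-∷=⁻ i z∈
... | inj₂ z∈L = there (subst (_ ∈_) (sym (points-∷= i)) (edge-end G z∈L B t e))
... | inj₁ refl with set⁻ A s f B t e
...   | inj₁ (refl , refl) = here refl
...   | inj₂ e′ = there (subst (_ ∈_) (sym (points-∷= i)) (edge-end G i B t e′))

-- A raised flag leads to a point of the tree, which the place of a new leaf is not. Hence attaching
-- a leaf raises the degree of its stem by exactly one.
no-edge : ∀ {L p f} → Grown L → (p , f) ∈ L → ∀ A s → move A s p ∉ points L → f A s ≡ false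
no-edge {f = f} G i A s v∉ with f A s in eq
... | false = refl
... | true  = contradiction (edge-end G i A s eq) v∉

deg-leaf-same : ∀ A s → deg A (set A (opp s) none) ≡ 1
deg-leaf-same A s = deg-set-same A (opp s) none refl

deg-leaf-other : ∀ A s → deg (other A) (set A (opp s) none) ≡ 0
deg-leaf-other A s = deg-set-other A (opp s) none

-- Corners and dominated points.

corners : Node → ℕ
corners (_ , f) = deg hor f * deg ver f

corners-axis : ∀ A x f → corners (x , f) ≡ deg A f * deg (other A) f
corners-axis hor x f = refl
corners-axis ver x f = *-comm (deg hor f) (deg ver f)

total : (Node → ℕ) → List Node → ℕ
total w L = sum (map w L)

-- `D` may repeat points: its length is an upper bound for the number of dominated points, and so
-- the count in `dominated` can be an equation.
Dominates : List Node → List Point → Set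
Dominates L D = ∀ {x} → x ∈ points L → x ∈ D × (∀ A s → move A s x ∈ D)

-- A new leaf v of p has three neighbours other than p, and the neighbour of v next to a
-- perpendicular tree edge at p was dominated before.
dominated : ∀ {L} → Grown L →
  ∃[ D ] Dominates L D × length D + total corners L ≡ 3 * length L + 2
dominated (root x) =
  x ∷ move hor fwd x ∷ move hor bwd x ∷ move ver fwd x ∷ move ver bwd x ∷ [] , dom , refl
  where
  dom : Dominates [ x , none ] _
  dom (here refl) = here refl , λ where
    hor fwd → there (here refl)
    hor bwd → there (there (here refl))
    ver fwd → there (there (there (here refl)))
    ver bwd → there (there (there (there (here refl))))
dominated (grow {L} {p} {f} G i A s v∉) with dominated G
... | D , dom , count = D′ , dom′ , count′
  where
  B = other A
  v = move A s p

  extra : Way → List Point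
  extra t = if f B t then [] else [ move B t v ]

  D′ = move A s v ∷ extra fwd ++ extra bwd ++ D

  p∈ : p ∈ points L
  p∈ = ∈-map⁺ proj₁ i

  old : D ⊆ D′
  old = there ∘ ∈-++⁺ʳ (extra fwd) ∘ ∈-++⁺ʳ (extra bwd)

  extra⊆ : ∀ t → extra t ⊆ D′
  extra⊆ fwd = there ∘ ∈-++⁺ˡ
  extra⊆ bwd = there ∘ ∈-++⁺ʳ (extra fwd) ∘ ∈-++⁺ˡ

  side : ∀ t → move B t v ∈ D′
  side t with f B t in eq | extra⊆ t
  ... | true  | _   = old (subst (_∈ D) (sym (move-comm A s t p)) (proj₂ (dom (edge-end G i B t eq)) A s))
  ... | false | sub = sub (here refl)

  dom′ : Dominates (leaf A s p ∷ (i ∷= (p , set A s f))) D′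
  -- The leaf was dominated by `p`. Of its neighbours, the one ahead heads `D′`, the one behind is
  -- `p`, and `side` settles the two others.
  dom′ (here refl) = old (proj₂ (dom p∈) A s) , axis-cases A
    (way-cases s (here refl) (old (subst (_∈ D) (sym (move-opp A s p)) (proj₁ (dom p∈)))))
    side
  dom′ (there x∈) with subst (_ ∈_) (points-∷= i) x∈
  ... | x∈L = old (proj₁ (dom x∈L)) , λ C t → old (proj₂ (dom x∈L) C t)

  extra-length : ∀ t → length (extra t) + bit (f B t) ≡ 1
  extra-length t with f B t
  ... | true  = refl
  ... | false = refl

  leaf-corners : corners (leaf A s p) ≡ 0
  leaf-corners rewrite corners-axis A (move A s p) (set A (opp s) none)
    | deg-leaf-other A s = *-zeroʳ (deg A (set A (opp s) none))

  -- The new edge forms a corner with each of the `deg B f` perpendicular edges at `p`, and `extra`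
  -- omits one point for each of them.
  stem-corners : corners (p , set A s f) + 0 ≡ corners (p , f) + deg B f
  stem-corners rewrite corners-axis A p (set A s f) | corners-axis A p f
    | deg-set-other A s f | deg-set-same A s f (no-edge G i A s v∉) =
    trans (+-identityʳ _) (+-comm (deg B f) _)

  T′ = total corners (i ∷= (p , set A s f))

  count′ : length D′ + total corners (leaf A s p ∷ (i ∷= (p , set A s f)))
         ≡ 3 * suc (length (i ∷= (p , set A s f))) + 2
  count′ = begin
    length D′ + (corners (leaf A s p) + T′)
      ≡⟨ cong (λ c → length D′ + (c + T′)) leaf-corners ⟩
    length D′ + T′
      ≡⟨ cong₂ (λ a b → suc a + b) D′-length (trans (sym (+-identityʳ T′)) (sum-∷= corners i stem-corners)) ⟩
    suc (e₁ + (e₂ + length D)) + (total corners L + (b₁ + b₂))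
      ≡⟨ arrange e₁ e₂ (length D) (total corners L) b₁ b₂ ⟩
    suc ((e₁ + b₁) + (e₂ + b₂) + (length D + total corners L))
      ≡⟨ cong suc (cong₂ _+_ (cong₂ _+_ (extra-length fwd) (extra-length bwd)) count) ⟩
    3 + (3 * length L + 2)
      ≡⟨ arrange′ (length L) ⟩
    3 * suc (length L) + 2
      ≡⟨ cong (λ l → 3 * suc l + 2) (sym (length-∷= i)) ⟩
    3 * suc (length (i ∷= (p , set A s f))) + 2 ∎
    where
    open ≡-Reasoning
    e₁ = length (extra fwd)
    e₂ = length (extra bwd)
    b₁ = bit (f B fwd)
    b₂ = bit (f B bwd)
    D′-length : length (extra fwd ++ extra bwd ++ D) ≡ e₁ + (e₂ + length D)
    D′-length = trans (List.length-++ (extra fwd)) (cong (e₁ +_) (List.length-++ (extra bwd)))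
    arrange : ∀ a b c d e f → suc (a + (b + c)) + (d + (e + f)) ≡ suc ((a + e) + (b + f) + (c + d))
    arrange = solve-∀
    arrange′ : ∀ l → 3 + (3 * l + 2) ≡ 3 * suc l + 2
    arrange′ = solve-∀

-- Counting maximal segments against corners.

other-involutive : ∀ A → other (other A) ≡ A
other-involutive hor = refl
other-involutive ver = refl

same-or-other : ∀ A B → B ≡ A ⊎ A ≡ other B
same-or-other hor hor = inj₁ refl
same-or-other hor ver = inj₂ refl
same-or-other ver hor = inj₂ refl
same-or-other ver ver = inj₁ refl

cross : Axis → Node → ℕ
cross A (_ , f) = deg (other A) f

-- The truncated difference is 1 exactly at a single-point segment. The factor 2 matches `cross`,
-- whose total counts each edge at both ends.
lone : Axis → Node → ℕ
lone A (_ , f) = 2 * (1 ∸ deg A f)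

-- A vertex without an edge in direction `A` lies on no segment of positive length, hence the first
-- alternative.
Carries : Axis → List Node → List ℤ → Set
Carries A L ls = ∀ {x f} → (x , f) ∈ L → deg A f ≡ 0 ⊎ level A x ∈ ls

-- Arithmetic common to the cases of `lines`: the leaf contributes `a` to the `lone` total and `b`
-- to the `cross` total, while at the stem the former drops by `j` and the latter rises by `k`.
count-step : ∀ h h′ {a b j k t t′ u u′ a₀ b₀} → a ≡ a₀ → b ≡ b₀ →
  t′ + j ≡ t + 0 → u′ + 0 ≡ u + k → 2 * h′ + a₀ ≡ 2 * h + (j + (b₀ + k)) →
  2 * h + t ≡ 2 + u → 2 * h′ + (a + t′) ≡ 2 + (b + u′)
count-step h h′ {a} {b} {j} {k} {t} {t′} {u} {u′} refl refl t-eq u-eq h-eq eq = +-cancelʳ-≡ j _ _ (begin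
  2 * h′ + (a + t′) + j              ≡⟨ regroup (2 * h′) a t′ j ⟩
  2 * h′ + a + (t′ + j)              ≡⟨ cong₂ _+_ h-eq t-eq ⟩
  2 * h + (j + (b + k)) + (t + 0)    ≡⟨ exchange (2 * h) (j + (b + k)) t ⟩
  2 * h + t + (j + (b + k))          ≡⟨ cong (_+ (j + (b + k))) eq ⟩
  2 + u + (j + (b + k))              ≡⟨ regroup′ u j b k ⟩
  2 + (b + (u + k)) + j              ≡⟨ cong (λ x → 2 + (b + x) + j) (trans (sym u-eq) (+-identityʳ u′)) ⟩
  2 + (b + u′) + j                   ∎)
  where
  open ≡-Reasoning
  regroup : ∀ h a t j → h + (a + t) + j ≡ h + a + (t + j)
  regroup = solve-∀
  exchange : ∀ h x t → h + x + (t + 0) ≡ h + t + x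
  exchange = solve-∀
  regroup′ : ∀ u j b k → 2 + u + (j + (b + k)) ≡ 2 + (b + (u + k)) + j
  regroup′ = solve-∀

-- Counts the maximal segments of the tree in direction A: the tree edges in the other direction
-- number one less than all segments including single points, and are half of total (cross A).
lines : ∀ A {L} → Grown L →
  ∃[ ls ] Carries A L ls × 2 * length ls + total (lone A) L ≡ 2 + total (cross A) L
lines A (root x) = [] , (λ { (here refl) → inj₁ refl }) , refl
lines A (grow {L} {p} {f} G i B s v∉) with lines A G | same-or-other A B
-- Edge perpendicular to `A`: the leaf is a new single-point segment, worth 2, and `cross` grows by
-- 1 at both ends of the edge.
... | ls , carries , count | inj₂ refl = ls , carries′ , count′
  where
  stem = p , set B s f

  carries′ : Carries A (leaf B s p ∷ (i ∷= stem)) ls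
  carries′ (here refl) = inj₁ (deg-leaf-other B s)
  carries′ (there z∈) with ∈-∷=⁻ i z∈
  ... | inj₂ z∈L  = carries z∈L
  ... | inj₁ refl with carries i
  ...   | inj₁ d≡0 = inj₁ (trans (deg-set-other B s f) d≡0)
  ...   | inj₂ p∈  = inj₂ p∈

  lone-leaf : lone A (leaf B s p) ≡ 2
  lone-leaf = cong (λ d → 2 * (1 ∸ d)) (deg-leaf-other B s)

  cross-leaf : cross A (leaf B s p) ≡ 1
  cross-leaf rewrite other-involutive B = deg-leaf-same B s

  lone-stem : lone A stem + 0 ≡ lone A (p , f) + 0
  lone-stem = cong (λ d → 2 * (1 ∸ d) + 0) (deg-set-other B s f)

  cross-stem : cross A stem + 0 ≡ cross A (p , f) + 1
  cross-stem rewrite other-involutive B | deg-set-same B s f (no-edge G i B s v∉) =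
    trans (+-identityʳ _) (+-comm 1 _)

  count′ : 2 * length ls + total (lone A) (leaf B s p ∷ (i ∷= stem))
         ≡ 2 + total (cross A) (leaf B s p ∷ (i ∷= stem))
  count′ = count-step (length ls) (length ls) lone-leaf cross-leaf
    (sum-∷= (lone A) i lone-stem) (sum-∷= (cross A) i cross-stem) refl count
... | ls , carries , count | inj₁ refl with deg A f in deg-p
-- The single point `p` and the leaf now form a segment: one more level, and `lone` drops by 2 at
-- `p`.
...   | zero = level A p ∷ ls , carries′ , count′
  where
  stem = p , set A s f

  stem-deg : deg A (set A s f) ≡ suc (deg A f)
  stem-deg = deg-set-same A s f (no-edge G i A s v∉)

  carries′ : Carries A (leaf A s p ∷ (i ∷= stem)) (level A p ∷ ls)
  carries′ (here refl) = inj₂ (here (level-along A s p))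
  carries′ (there z∈) with ∈-∷=⁻ i z∈
  ... | inj₁ refl = inj₂ (here refl)
  ... | inj₂ z∈L with carries z∈L
  ...   | inj₁ d≡0 = inj₁ d≡0
  ...   | inj₂ x∈  = inj₂ (there x∈)

  lone-stem : lone A stem + 2 ≡ lone A (p , f) + 0
  lone-stem rewrite stem-deg | deg-p = refl

  cross-stem : cross A stem + 0 ≡ cross A (p , f) + 0
  cross-stem = cong (_+ 0) (deg-set-other A s f)

  count′ : 2 * suc (length ls) + total (lone A) (leaf A s p ∷ (i ∷= stem))
         ≡ 2 + total (cross A) (leaf A s p ∷ (i ∷= stem))
  count′ = count-step (length ls) (suc (length ls))
    (cong (λ d → 2 * (1 ∸ d)) (deg-leaf-same A s)) (deg-leaf-other A s)
    (sum-∷= (lone A) i lone-stem) (sum-∷= (cross A) i cross-stem)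
    (trans (+-identityʳ _) (trans (*-suc 2 (length ls)) (+-comm 2 _))) count
-- The leaf prolongs a segment through `p`, so neither side of the count changes.
...   | suc d = ls , carries′ , count′
  where
  stem = p , set A s f

  stem-deg : deg A (set A s f) ≡ suc (deg A f)
  stem-deg = deg-set-same A s f (no-edge G i A s v∉)

  p∈ls : level A p ∈ ls
  p∈ls with carries i
  ... | inj₁ d≡0 = contradiction (trans (sym deg-p) d≡0) λ ()
  ... | inj₂ p∈  = p∈

  carries′ : Carries A (leaf A s p ∷ (i ∷= stem)) ls
  carries′ (here refl) = inj₂ (subst (_∈ ls) (sym (level-along A s p)) p∈ls)
  carries′ (there z∈) with ∈-∷=⁻ i z∈
  ... | inj₁ refl = inj₂ p∈ls
  ... | inj₂ z∈L  = carries z∈L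

  lone-stem : lone A stem + 0 ≡ lone A (p , f) + 0
  lone-stem rewrite stem-deg | deg-p | 0∸n≡0 d = refl

  cross-stem : cross A stem + 0 ≡ cross A (p , f) + 0
  cross-stem = cong (_+ 0) (deg-set-other A s f)

  count′ : 2 * length ls + total (lone A) (leaf A s p ∷ (i ∷= stem))
         ≡ 2 + total (cross A) (leaf A s p ∷ (i ∷= stem))
  count′ = count-step (length ls) (length ls)
    (cong (λ d → 2 * (1 ∸ d)) (deg-leaf-same A s)) (deg-leaf-other A s)
    (sum-∷= (lone A) i lone-stem) (sum-∷= (cross A) i cross-stem) refl count


-- Where there is an edge in direction `A`, each perpendicular edge forms a corner with it.
-- Elsewhere `lone` is 2, and there are at most two perpendicular edges.
cross≤corners+lone : ∀ A z → cross A z ≤ corners z + lone A z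
cross≤corners+lone A z@(x , f) rewrite corners-axis A x f with deg A f
... | suc d = ≤-trans (m≤m+n (cross A z) (d * cross A z)) (m≤m+n _ _)
... | zero  = +-mono-≤ (bit≤1 (f (other A) fwd)) (bit≤1 (f (other A) bwd))
  where
  bit≤1 : ∀ b → bit b ≤ 1
  bit≤1 true  = s≤s z≤n
  bit≤1 false = z≤n

lines≤corners : ∀ A {L} (G : Grown L) → 2 * length (proj₁ (lines A G)) ≤ 2 + total corners L
lines≤corners A {L} G with lines A G
... | ls , _ , count = +-cancelʳ-≤ (total (lone A) L) _ _ (begin
  2 * length ls + total (lone A) L            ≡⟨ count ⟩
  2 + total (cross A) L                       ≤⟨ +-monoʳ-≤ 2 (sum-mono L) ⟩
  2 + (total corners L + total (lone A) L)    ≡⟨ sym (+-assoc 2 (total corners L) _) ⟩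
  2 + total corners L + total (lone A) L      ∎)
  where
  open ≤-Reasoning
  swap : ∀ a b c d → (a + b) + (c + d) ≡ (a + c) + (b + d)
  swap = solve-∀
  sum-mono : ∀ L → total (cross A) L ≤ total corners L + total (lone A) L
  sum-mono []      = z≤n
  sum-mono (z ∷ L) = ≤-trans (+-mono-≤ (cross≤corners+lone A z) (sum-mono L))
    (≤-reflexive (swap (corners z) (lone A z) (total corners L) (total (lone A) L)))

-- Vertices with a tree edge.

Busy : Node → Set
Busy (_ , f) = ∃[ A ] deg A f ≢ 0

-- Attaching a leaf makes both the leaf and its stem busy. If the tree was a lone root before, that
-- root is the stem.
busy : ∀ {L} → Grown L → length L ≡ 1 ⊎ (∀ {z} → z ∈ L → Busy z)
busy (root x) = inj₁ refl
busy (grow {L} {p} {f} G i A s v∉) = inj₂ λ where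
    (here refl) → A , λ e → contradiction (trans (sym (deg-leaf-same A s)) e) λ ()
    (there z∈)  → rest (busy G) z∈
  where
  stem-busy : Busy (p , set A s f)
  stem-busy = A , λ e → contradiction (trans (sym (deg-set-same A s f (no-edge G i A s v∉))) e) λ ()

  rest : length L ≡ 1 ⊎ (∀ {z} → z ∈ L → Busy z) → ∀ {z} → z ∈ (i ∷= (p , set A s f)) → Busy z
  rest (inj₂ all) z∈ with ∈-∷=⁻ i z∈
  ... | inj₁ refl = stem-busy
  ... | inj₂ z∈L  = all z∈L
  rest (inj₁ one) z∈ = single i one z∈
    where
    single : ∀ {L} (i : (p , f) ∈ L) → length L ≡ 1 → ∀ {z} → z ∈ (i ∷= (p , set A s f)) → Busy z
    single {_ ∷ []} (here refl) _ (here refl) = stem-busy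

-- The grid inside ℤ² and a spanning tree of `S`.

dist≡0 : ∀ a b → dist a b ≡ 0 → a ≡ b
dist≡0 zero    zero    _ = refl
dist≡0 (suc a) (suc b) e = cong suc (dist≡0 a b e)

dist≡1 : ∀ a b → dist a b ≡ 1 → b ≡ suc a ⊎ a ≡ suc b
dist≡1 zero    (suc zero) _ = inj₁ refl
dist≡1 (suc zero) zero _ = inj₂ refl
dist≡1 (suc a) (suc b) e with dist≡1 a b e
... | inj₁ eq = inj₁ (cong suc eq)
... | inj₂ eq = inj₂ (cong suc eq)

dist≡1⇒shift : ∀ a b → dist a b ≡ 1 → ∃[ s ] ℤ.+ b ≡ shift s (ℤ.+ a)
dist≡1⇒shift a b e with dist≡1 a b e
... | inj₁ refl = fwd , refl
... | inj₂ refl = bwd , sym (ℤ.pred-suc (ℤ.+ b))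

emb : Vertex n m → Point
emb (i , j) = ℤ.+ toℕ i , ℤ.+ toℕ j

emb-injective : {u v : Vertex n m} → emb u ≡ emb v → u ≡ v
emb-injective e = cong₂ _,_
  (Fin.toℕ-injective (ℤ.+-injective (cong proj₁ e))) (Fin.toℕ-injective (ℤ.+-injective (cong proj₂ e)))

Adj⇒move : {u v : Vertex n m} → Adj u v → ∃[ A ] ∃[ s ] emb v ≡ move A s (emb u)
Adj⇒move {u = i , j} {i′ , j′} adj
  with dist (toℕ i) (toℕ i′) in eᵢ | dist (toℕ j) (toℕ j′) in eⱼ
Adj⇒move {u = i , j} {i′ , j′} refl | zero | suc zero with dist≡1⇒shift (toℕ j) (toℕ j′) eⱼ
... | s , e = hor , s , cong₂ _,_ (cong ℤ.+_ (sym (dist≡0 (toℕ i) (toℕ i′) eᵢ))) e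
Adj⇒move {u = i , j} {i′ , j′} refl | suc zero | zero with dist≡1⇒shift (toℕ i) (toℕ i′) eᵢ
... | s , e = ver , s , cong₂ _,_ e (cong ℤ.+_ (sym (dist≡0 (toℕ j) (toℕ j′) eⱼ)))

open DecMembership (≡-dec ℤ._≟_ ℤ._≟_) using (_∈?_)

reach-source : {S : List (Vertex n m)} → ∀ {u w} → Reach S u w → u ∈ S
reach-source (here u∈)     = u∈
reach-source (step u∈ _ _) = u∈

-- Walks along the path and attaches each vertex not yet in the tree to its predecessor, which is.
-- Old points are kept, so the vertices of `S` can be absorbed one after another.
extend : (S : List (Vertex n m)) → ∀ {L u w} →
  Grown L → points L ⊆ map emb S → emb u ∈ points L → Reach S u w →
  ∃[ L′ ] Grown L′ × points L′ ⊆ map emb S × points L ⊆ points L′ × emb w ∈ points L′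
extend S {L} G fits u∈ (here _) = L , G , fits , id , u∈
extend S {L} G fits u∈ (step {v = v} _ adj path) with emb v ∈? points L
... | yes v∈ = extend S G fits v∈ path
... | no v∉ with Adj⇒move adj | ∈-map⁻ proj₁ u∈
...   | A , s , e | _ , i , refl
  with extend S (grow G i A s (subst (_∉ points L) e v∉)) fits′ (here e) path
  where
  fits′ : points (leaf A s _ ∷ (i ∷= _)) ⊆ map emb S
  fits′ (here refl) = subst (_∈ map emb S) e (∈-map⁺ emb (reach-source path))
  fits′ (there x∈)  = fits (subst (_ ∈_) (points-∷= i) x∈)
...     | L′ , G′ , fits″ , sub , w∈ =
  L′ , G′ , fits″ , sub ∘ there ∘ subst (_ ∈_) (sym (points-∷= i)) , w∈

spanning-tree : (S : List (Vertex n m)) → ∀ {r} → (∀ {v} → v ∈ S → Reach S r v) → r ∈ S →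
  ∃[ L ] Grown L × points L ⊆ map emb S × (∀ {v} → v ∈ S → emb v ∈ points L)
spanning-tree S {r} reach r∈ with absorb S reach
  where
  absorb : ∀ xs → (∀ {v} → v ∈ xs → Reach S r v) →
    ∃[ L ] Grown L × points L ⊆ map emb S × emb r ∈ points L × (∀ {v} → v ∈ xs → emb v ∈ points L)
  absorb [] _ = [ emb r , none ] , root (emb r) , (λ { (here refl) → ∈-map⁺ emb r∈ }) , here refl , λ ()
  absorb (x ∷ xs) reach with absorb xs (reach ∘ there)
  ... | L , G , fits , r∈L , all with extend S G fits r∈L (reach (here refl))
  ...   | L′ , G′ , fits′ , sub , x∈ =
    L′ , G′ , fits′ , sub r∈L , λ { (here refl) → x∈ ; (there v∈) → sub (all v∈) }
... | L , G , fits , _ , all = L , G , fits , all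

-- Segments near every row or near every column.

Close : Point → Point → Set
Close x y = x ≡ y ⊎ ∃[ A ] ∃[ s ] y ≡ move A s x

Close-sym : ∀ {x y} → Close x y → Close y x
Close-sym (inj₁ e)             = inj₁ (sym e)
Close-sym (inj₂ (A , s , refl)) = inj₂ (A , opp s , sym (move-opp A s _))

dominator : {S : List (Vertex n m)} → Dominating S → ∀ v → ∃[ u ] u ∈ S × Close (emb u) (emb v)
dominator dom v with dom v
... | inj₁ v∈            = v , v∈ , inj₁ refl
... | inj₂ (u , u∈ , adj) = u , u∈ , inj₂ (Adj⇒move adj)

-- A segment dominates only points on its own line and the two adjacent ones; this is the source of
-- the inner division by 3.
near : ℤ → List ℤ
near z = z ∷ shift fwd z ∷ shift bwd z ∷ []

Close⇒near : ∀ A {x y} → Close x y → level A y ∈ near (level A x)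
Close⇒near A (inj₁ refl) = here refl
Close⇒near hor (inj₂ (hor , s , refl)) = here refl
Close⇒near ver (inj₂ (ver , s , refl)) = here refl
Close⇒near hor (inj₂ (ver , fwd , refl)) = there (here refl)
Close⇒near hor (inj₂ (ver , bwd , refl)) = there (there (here refl))
Close⇒near ver (inj₂ (hor , fwd , refl)) = there (here refl)
Close⇒near ver (inj₂ (hor , bwd , refl)) = there (there (here refl))

length-near : ∀ ls → length (concatMap near ls) ≡ 3 * length ls
length-near []       = refl
length-near (_ ∷ ls) = trans (cong (3 +_) (length-near ls)) (sym (*-suc 3 (length ls)))

module ℤ∈ = DecMembership ℤ._≟_

-- Pigeonhole: the `near` lists have `3 * length ls` entries altogether, too few for `N` distinct
-- levels.
uncovered : ∀ N ls → 3 * length ls < N →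
  ∃[ r ] (∀ {z} → z ∈ ls → ℤ.+ toℕ {N} r ∉ near z)
uncovered N ls small with Fin.all? (λ r → (ℤ.+ toℕ {N} r) ℤ∈.∈? concatMap near ls)
... | yes all = contradiction (begin-strict
    N                                        ≡⟨ sym (List.length-tabulate (ℤ.+_ ∘ toℕ {N})) ⟩
    length (tabulate (ℤ.+_ ∘ toℕ {N}))       ≤⟨ Unique∧⊆⇒length≤ unique sub ⟩
    length (concatMap near ls)               ≡⟨ length-near ls ⟩
    3 * length ls                            <⟨ small ⟩
    N                                        ∎) (<-irrefl refl)
  where
  open ≤-Reasoning
  unique : Unique (tabulate (ℤ.+_ ∘ toℕ {N}))
  unique = Unique.tabulate⁺ (Fin.toℕ-injective ∘ ℤ.+-injective)
  sub : tabulate (ℤ.+_ ∘ toℕ {N}) ⊆ concatMap near ls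
  sub z∈ with ∈-tabulate⁻ z∈
  ... | r , refl = all r
... | no ¬all with Fin.¬∀⟶∃¬ N _ (λ r → (ℤ.+ toℕ r) ℤ∈.∈? concatMap near ls) ¬all
...   | r , r∉ = r , λ z∈ r∈ → r∉ (∈-concatMap⁺ near (Any.map (λ { refl → r∈ }) z∈))

size : ℕ → ℕ → Axis → ℕ
size n m hor = n
size n m ver = m

-- A row missed by all horizontal lines and a column missed by all vertical ones meet in a vertex
-- that is not dominated.
lines-cover : {S : List (Vertex n m)} → Dominating S → ∀ {L} (G : Grown L) →
  (∀ {v} → v ∈ S → emb v ∈ points L) → (∀ {z} → z ∈ L → Busy z) →
  ∃[ A ] size n m A ≤ 3 * length (proj₁ (lines A G))
lines-cover {n} {m} dom G spans all-busy
  with n ≤? 3 * length (proj₁ (lines hor G)) | m ≤? 3 * length (proj₁ (lines ver G))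
... | yes n≤ | _      = hor , n≤
... | no _   | yes m≤ = ver , m≤
... | no n≰  | no m≰
  with uncovered n _ (≰⇒> n≰) | uncovered m _ (≰⇒> m≰)
... | r , r∉ | c , c∉ with dominator dom (r , c)
...   | u , u∈ , close with ∈-map⁻ proj₁ (spans u∈)
...     | z , z∈ , refl with all-busy z∈
-- The dominating vertex has a tree edge, so its row or its column is the level of a segment, near
-- `r` or `c` respectively.
...       | hor , d≢0 with proj₁ (proj₂ (lines hor G)) z∈
...         | inj₁ d≡0 = contradiction d≡0 d≢0
...         | inj₂ ℓ∈  = contradiction (Close⇒near hor close) (r∉ ℓ∈)
lines-cover {n} {m} dom G spans all-busy | no n≰ | no m≰ | r , r∉ | c , c∉ | u , u∈ , close
  | z , z∈ , refl | ver , d≢0 with proj₁ (proj₂ (lines ver G)) z∈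
...         | inj₁ d≡0 = contradiction d≡0 d≢0
...         | inj₂ ℓ∈  = contradiction (Close⇒near ver close) (c∉ ℓ∈)

-- Dominated points off the grid.

-- Tells the two ends of a side apart even after one step: from 0 one reaches at most 1, from the
-- last coordinate at least 2, as sides have length at least 4.
low : ℤ → Bool
low (ℤ.+ 0)           = true
low (ℤ.+ 1)           = true
low (ℤ.+ suc (suc _)) = false
low ℤ.-[1+ _ ]        = true

record End (N : ℕ) (b : Bool) : Set where
  field
    end   : Fin N
    way   : Way
    out   : ∀ (i : Fin N) → shift way (ℤ.+ toℕ end) ≢ ℤ.+ toℕ i
    at    : low (ℤ.+ toℕ end) ≡ b
    close : ∀ t → low (shift t (ℤ.+ toℕ end)) ≡ b

low-end : ∀ k → End (4 + k) true
low-end k = record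
  { end = zero ; way = bwd ; out = λ _ () ; at = refl ; close = λ { fwd → refl ; bwd → refl } }

high-end : ∀ k → End (4 + k) false
high-end k = record
  { end   = fromℕ (3 + k)
  ; way   = fwd
  ; out   = λ i e → <-irrefl (sym (trans (cong suc (sym (Fin.toℕ-fromℕ (3 + k)))) (ℤ.+-injective e))) (Fin.toℕ<n i)
  ; at    = subst (λ x → low (ℤ.+ x) ≡ false) (sym (Fin.toℕ-fromℕ (3 + k))) refl
  ; close = λ t → subst (λ x → low (shift t (ℤ.+ x)) ≡ false) (sym (Fin.toℕ-fromℕ (3 + k))) (steps t)
  }
  where
  steps : ∀ t → low (shift t (ℤ.+ (3 + k))) ≡ false
  steps fwd = refl
  steps bwd = refl

-- Some neighbour of the vertex dominating a corner lies off the grid.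
off-corner : {S : List (Vertex n m)} → Dominating S → ∀ {D} →
  (∀ {v} → v ∈ S → ∀ A s → move A s (emb v) ∈ D) → ∀ {b c} → End n b → End m c →
  ∃[ o ] o ∈ D × (∀ (v : Vertex n m) → o ≢ emb v) × low (proj₁ o) ≡ b × low (proj₂ o) ≡ c
off-corner {n} {m} dom {D} nbrs E F with dominator dom (End.end E , End.end F)
... | u , u∈ , c with Close-sym c
-- From the corner or its neighbour in the same row, a vertical step leaves the grid; from its
-- neighbour in the same column, a horizontal one does.
... | inj₁ e = _ , subst (λ x → move ver E.way x ∈ D) (sym e) (nbrs u∈ ver E.way) ,
    (λ v → E.out (proj₁ v) ∘ cong proj₁) , E.close E.way , F.at
  where module E = End E ; module F = End F
... | inj₂ (hor , t , e) = _ , subst (λ x → move ver E.way x ∈ D) e (nbrs u∈ ver E.way) ,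
    (λ v → E.out (proj₁ v) ∘ cong proj₁) , E.close E.way , F.close t
  where module E = End E ; module F = End F
... | inj₂ (ver , t , e) = _ , subst (λ x → move hor F.way x ∈ D) e (nbrs u∈ hor F.way) ,
    (λ v → F.out (proj₂ v) ∘ cong proj₂) , E.close t , F.close F.way
  where module E = End E ; module F = End F

separated : (g : X → Bool) {x y : X} {b c : Bool} → g x ≡ b → g y ≡ c → b ≢ c → x ≢ y
separated g refl refl b≢c refl = b≢c refl

grid : ∀ n m → List Point
grid n m = tabulate (emb ∘ remQuot {n} m)

grid-unique : ∀ n m → Unique (grid n m)
grid-unique n m = Unique.tabulate⁺ λ {k} {l} e → trans (sym (Fin.combine-remQuot {n} m k))
  (trans (cong (uncurry combine) (emb-injective e)) (Fin.combine-remQuot {n} m l))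

-- `D` contains all grid vertices and an outside point for each corner; these four points are
-- distinct because their pairs of `low` values are.
dominated-count : ∀ k l {S : List (Vertex (4 + k) (4 + l))} → Dominating S → ∀ {D} →
  (∀ {v} → v ∈ S → emb v ∈ D × ∀ A s → move A s (emb v) ∈ D) →
  4 + (4 + k) * (4 + l) ≤ length D
dominated-count k l {S} dom {D} nbrs
  with off-corner dom (proj₂ ∘ nbrs) (low-end k) (low-end l)
     | off-corner dom (proj₂ ∘ nbrs) (low-end k) (high-end l)
     | off-corner dom (proj₂ ∘ nbrs) (high-end k) (low-end l)
     | off-corner dom (proj₂ ∘ nbrs) (high-end k) (high-end l)
... | o₁ , o₁∈ , off₁ , r₁ , c₁ | o₂ , o₂∈ , off₂ , r₂ , c₂
    | o₃ , o₃∈ , off₃ , r₃ , c₃ | o₄ , o₄∈ , off₄ , r₄ , c₄ = begin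
  4 + N * M                          ≡⟨ cong (4 +_) (sym (List.length-tabulate (emb ∘ remQuot {N} M))) ⟩
  length (os ++ grid N M)            ≤⟨ Unique∧⊆⇒length≤ (Unique.++⁺ os-unique (grid-unique N M) disjoint) sub ⟩
  length D                           ∎
  where
  open ≤-Reasoning
  N = 4 + k
  M = 4 + l

  os : List Point
  os = o₁ ∷ o₂ ∷ o₃ ∷ o₄ ∷ []

  row col : Point → Bool
  row = low ∘ proj₁
  col = low ∘ proj₂

  os-unique : Unique os
  os-unique =
      (separated col c₁ c₂ (λ ()) ∷ separated row r₁ r₃ (λ ()) ∷ separated row r₁ r₄ (λ ()) ∷ [])
    ∷ (separated row r₂ r₃ (λ ()) ∷ separated row r₂ r₄ (λ ()) ∷ [])
    ∷ (separated col c₃ c₄ (λ ()) ∷ [])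
    ∷ [] ∷ []

  off : All (λ o → ∀ (v : Vertex N M) → o ≢ emb v) os
  off = off₁ ∷ off₂ ∷ off₃ ∷ off₄ ∷ []

  disjoint : ∀ {x} → ¬ (x ∈ os × x ∈ grid N M)
  disjoint (x∈os , x∈grid) with ∈-tabulate⁻ {f = emb ∘ remQuot {N} M} x∈grid
  ... | i , refl = All.lookup off x∈os (remQuot {N} M i) refl

  sub : os ++ grid N M ⊆ D
  sub x∈ with ∈-++⁻ os x∈
  ... | inj₁ x∈os = All.lookup (o₁∈ ∷ o₂∈ ∷ o₃∈ ∷ o₄∈ ∷ []) x∈os
  ... | inj₂ x∈grid with ∈-tabulate⁻ {f = emb ∘ remQuot {N} M} x∈grid
  ...   | i , refl with dominator dom (remQuot {N} M i)
  ...     | u , u∈ , inj₁ e           = subst (_∈ D) e (proj₁ (nbrs u∈))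
  ...     | u , u∈ , inj₂ (A , s , e) = subst (_∈ D) (sym e) (proj₂ (nbrs u∈) A s)

-- The final estimate.

≤3*⇒⌈/3⌉≤ : ∀ {a b} → a ≤ 3 * b → ⌈ a /3⌉ ≤ b
≤3*⇒⌈/3⌉≤ {a} {b} a≤ = ≤-pred (m<n*o⇒m/o<n {a + 2} {suc b} {3} (begin-strict
  a + 2        <⟨ +-monoʳ-< a (n<1+n 2) ⟩
  a + 3        ≤⟨ +-monoˡ-≤ 3 a≤ ⟩
  3 * b + 3    ≡⟨ +-comm (3 * b) 3 ⟩
  3 + 3 * b    ≡⟨ cong (3 +_) (*-comm 3 b) ⟩
  suc b * 3    ∎))
  where open ≤-Reasoning

min≤size : ∀ n m A → m ⊓ n ≤ size n m A
min≤size n m hor = m⊓n≤n m n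
min≤size n m ver = m⊓n≤m m n

theorem3 : ∀ (n m : ℕ) → 4 ≤ n → 4 ≤ m → (S : List (Vertex n m)) → Unique S →
    IsConnectedDominatingSet S →
    ⌈ m * n + 2 * ⌈ m ⊓ n /3⌉ /3⌉ ≤ length S
theorem3 n@(suc (suc (suc (suc k)))) m@(suc (suc (suc (suc l))))
  (s≤s (s≤s (s≤s (s≤s _)))) (s≤s (s≤s (s≤s (s≤s _)))) S _ (connected , dom)
  -- Any vertex of `S` can be the root; the dominator of a corner supplies one.
  with dominator dom (zero , zero)
... | r , r∈ , _ with spanning-tree S (connected r∈) r∈
... | L , G , fits , spans with dominated G
-- The 4 on the left stands for the off-grid points; on the right, 2 comes from `dominated` and 2
-- from `lines≤corners`.
... | D , D-dom , count = ≤3*⇒⌈/3⌉≤ (+-cancelˡ-≤ 4 _ _ (begin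
  4 + (m * n + 2 * c)                     ≤⟨ +-monoʳ-≤ 4 (+-monoʳ-≤ (m * n) (*-monoʳ-≤ 2 c≤h)) ⟩
  4 + (m * n + 2 * h)                     ≤⟨ +-monoʳ-≤ 4 (+-monoʳ-≤ (m * n) (lines≤corners A G)) ⟩
  4 + (m * n + (2 + total corners L))     ≡⟨ arrange (m * n) (total corners L) ⟩
  4 + m * n + total corners L + 2         ≡⟨ cong (λ x → 4 + x + total corners L + 2) (*-comm m n) ⟩
  4 + n * m + total corners L + 2         ≤⟨ +-monoˡ-≤ 2 (+-monoˡ-≤ (total corners L) D-large) ⟩
  length D + total corners L + 2          ≡⟨ cong (_+ 2) count ⟩
  3 * length L + 2 + 2                    ≡⟨ arrange′ (length L) ⟩
  4 + 3 * length L                        ≤⟨ +-monoʳ-≤ 4 (*-monoʳ-≤ 3 L≤S) ⟩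
  4 + 3 * length S                        ∎))
  where
  open ≤-Reasoning

  arrange : ∀ x t → 4 + (x + (2 + t)) ≡ 4 + x + t + 2
  arrange = solve-∀

  arrange′ : ∀ x → 3 * x + 2 + 2 ≡ 4 + 3 * x
  arrange′ = solve-∀

  D-large : 4 + n * m ≤ length D
  D-large = dominated-count k l dom (λ v∈ → D-dom (spans v∈))

  -- For a single vertex `count` would give 5, less than `4 + n * m`.
  not-single : length L ≢ 1
  not-single one = contradiction
    (≤-trans (≤-trans D-large (m≤m+n (length D) (total corners L)))
      (≤-reflexive (trans count (cong (λ x → 3 * x + 2) one))))
    λ { (s≤s (s≤s (s≤s (s≤s (s≤s ()))))) }

  all-busy : ∀ {z} → z ∈ L → Busy z
  all-busy with busy G
  ... | inj₁ one = contradiction one not-single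
  ... | inj₂ all = all

  covering : ∃[ A ] size n m A ≤ 3 * length (proj₁ (lines A G))
  covering = lines-cover dom G spans all-busy

  A = proj₁ covering
  h = length (proj₁ (lines A G))
  c = ⌈ m ⊓ n /3⌉

  c≤h : c ≤ h
  c≤h = ≤3*⇒⌈/3⌉≤ (≤-trans (min≤size n m A) (proj₂ covering))

  L≤S : length L ≤ length S
  L≤S = subst₂ _≤_ (List.length-map proj₁ L) (List.length-map emb S)
    (Unique∧⊆⇒length≤ (grown-unique G) fits)
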